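{- Let $F$ be a one-dimensional tropical fan in $\mathbb{R}^n$ whose rays span $\mathbb{R}^n$. Let $P=\{\mathbb{R}_+v_0,\dots,\mathbb{R}_+v_k\}$ be a gallery class of $F$ with $k+1\ge2$ distinct rays, with primitive generators $v_0,\dots,v_k$. Fix $i\in\{0,\dots,k\}$ and, for $j\in\{0,\dots,k\}\setminus\{i\}$, let $l_{ij}\in(\mathbb{Z}^n)^\vee$ be the unique functional with $g_{l_{ij}}(v_i,v_j)\in\mathrm{Gly}(F)$. Then the $k$ linear functionals $l_{ij}$ ($j\ne i$) are linearly independent. Moreover, if $\pi:\mathbb{Z}^n\to\mathbb{Z}^k$ is the homomorphism given by the integer matrix whose rows are the $l_{ij}$ ($j\neq i$), then $|\mathbb{Z}^k/\pi(\mathbb{Z}^n)|=1$.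
   Context: A one-dimensional tropical fan $F$ in $\mathbb{R}^n$ consists of finitely many distinct rays $\mathbb{R}_+v$ (and the origin), each with primitive generator $v\in\mathbb{Z}^n$ and a positive integer weight $\omega_v$, satisfying the balancing condition $\sum_v\omega_vv=0$. For $l\in(\mathbb{Z}^n)^\vee$ put $\max(0,l)\cdot F=\sum_v\omega_v\max(0,l(v))$. If this equals $1$, the gallery of $F$ over $\max(0,l)$ is the set of rays $\mathbb{R}_+v$ of $F$ with $|l(v)|=1$. $\mathrm{Gly}(F)$ is the set of all galleries of $F$. The notation $g_l(v_a,v_b)\in\mathrm{Gly}(F)$ means that $\max(0,l)\cdot F=1$, that the gallery over $\max(0,l)$ is $\{\mathbb{R}_+v_a,\mathbb{R}_+v_b\}$, and that $l(v_a)=1$, $l(v_b)=-1$; equivalently, $l(v_a)=1$, $l(v_b)=-1$, both rays have weight $1$, and $l(v)=0$ for all other primitive generators $v$ of $F$. Such an $l$ is unique given $(v_a,v_b)$. The relation on rays "equal, or together forming a gallery of $F$" is an equivalence relation; its equivalence classes are called gallery classes here. -}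

module Defs where

import Algebra.Properties.Semiring.Sum
open import Data.Fin.Base using (Fin)
open import Data.Integer.Base as ℤ using (ℤ; 0ℤ; 1ℤ; -1ℤ; +_)
open import Data.Integer.Divisibility using (_∣_)
import Data.Integer.Properties as ℤ
open import Data.Integer.Tactic.RingSolver using (solve-∀)
open import Data.Nat.Base as ℕ using (ℕ)
import Data.Nat.Properties as ℕ
open import Data.Product.Base using (Σ-syntax; ∃-syntax; _×_; _,_)
open import Data.Rational.Base as ℚ using (ℚ; 0ℚ; 1ℚ; ½)
import Data.Rational.Properties as ℚ
open import Data.Rational.Solver using (module +-*-Solver)
open import Data.Sum.Base using (_⊎_)
open import Data.Vec.Functional using (Vector; foldr)
open import Function.Bundles using (Inverse)
open import Level using (0ℓ)
open import Relation.Binary.Bundles using (Setoid)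
open import Relation.Binary.PropositionalEquality using (_≡_; refl; sym; trans; cong; cong₂; subst; setoid; module ≡-Reasoning)
open import Relation.Unary using (Pred; _≐_; _∪_; ｛_｝)

module Sumℤ = Algebra.Properties.Semiring.Sum ℤ.+-*-semiring
open Sumℤ using () renaming (sum to sumℤ)

-- Cauchy reals.  Only the additive group and multiplication by integers
-- are needed: real linear combinations are taken of integer vectors only.

record ℝ : Set where
  constructor mkℝ
  field
    seq    : ℕ → ℚ
    cauchy : ∀ ε → 0ℚ ℚ.< ε →
             ∃[ N ] (∀ m n → N ℕ.≤ m → N ℕ.≤ n → ℚ.∣ seq m ℚ.- seq n ∣ ℚ.< ε)

open ℝ public

infix  4 _≈ℝ_
infixl 6 _+ℝ_
infixl 7 _·ℝ_

_≈ℝ_ : ℝ → ℝ → Set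
x ≈ℝ y = ∀ ε → 0ℚ ℚ.< ε →
         ∃[ N ] (∀ n → N ℕ.≤ n → ℚ.∣ seq x n ℚ.- seq y n ∣ ℚ.< ε)

0ℝ : ℝ
0ℝ = mkℝ (λ _ → 0ℚ) (λ ε 0<ε → 0 , λ _ _ _ _ → 0<ε)

private
  0<½*ε : ∀ {ε} → 0ℚ ℚ.< ε → 0ℚ ℚ.< ½ ℚ.* ε
  0<½*ε {ε} 0<ε = subst (ℚ._< ½ ℚ.* ε) (ℚ.*-zeroʳ ½) (ℚ.*-monoʳ-<-pos ½ 0<ε)

  ½+½ : ∀ ε → ½ ℚ.* ε ℚ.+ ½ ℚ.* ε ≡ ε
  ½+½ ε = trans (sym (ℚ.*-distribʳ-+ ε ½ ½)) (ℚ.*-identityˡ ε)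

  +-interchange : ∀ a b c d →
    (a ℚ.+ b) ℚ.- (c ℚ.+ d) ≡ (a ℚ.- c) ℚ.+ (b ℚ.- d)
  +-interchange = solve 4 (λ a b c d →
    (a :+ b) :+ (:- (c :+ d)) := (a :+ (:- c)) :+ (b :+ (:- d))) refl
    where open +-*-Solver

  *-factor : ∀ q a b → q ℚ.* a ℚ.- q ℚ.* b ≡ q ℚ.* (a ℚ.- b)
  *-factor = solve 3 (λ q a b →
    (q :* a) :+ (:- (q :* b)) := q :* (a :+ (:- b))) refl
    where open +-*-Solver

_+ℝ_ : ℝ → ℝ → ℝ
x +ℝ y = mkℝ (λ n → seq x n ℚ.+ seq y n) λ ε 0<ε →
  let M , hx = cauchy x (½ ℚ.* ε) (0<½*ε 0<ε)
      N , hy = cauchy y (½ ℚ.* ε) (0<½*ε 0<ε)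
  in M ℕ.⊔ N , λ m n M⊔N≤m M⊔N≤n →
    let open ℚ.≤-Reasoning in begin-strict
    ℚ.∣ (seq x m ℚ.+ seq y m) ℚ.- (seq x n ℚ.+ seq y n) ∣
      ≡⟨ cong ℚ.∣_∣ (+-interchange (seq x m) (seq y m) (seq x n) (seq y n)) ⟩
    ℚ.∣ (seq x m ℚ.- seq x n) ℚ.+ (seq y m ℚ.- seq y n) ∣
      ≤⟨ ℚ.∣p+q∣≤∣p∣+∣q∣ (seq x m ℚ.- seq x n) (seq y m ℚ.- seq y n) ⟩
    ℚ.∣ seq x m ℚ.- seq x n ∣ ℚ.+ ℚ.∣ seq y m ℚ.- seq y n ∣
      <⟨ ℚ.+-mono-<
           (hx m n (ℕ.m⊔n≤o⇒m≤o M N M⊔N≤m) (ℕ.m⊔n≤o⇒m≤o M N M⊔N≤n))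
           (hy m n (ℕ.m⊔n≤o⇒n≤o M N M⊔N≤m) (ℕ.m⊔n≤o⇒n≤o M N M⊔N≤n)) ⟩
    ½ ℚ.* ε ℚ.+ ½ ℚ.* ε
      ≡⟨ ½+½ ε ⟩
    ε ∎

_·ℝ_ : ℤ → ℝ → ℝ
z ·ℝ x = mkℝ (λ n → q ℚ.* seq x n) λ ε 0<ε →
  let N , h = cauchy x (B⁻¹ ℚ.* ε)
                (subst (ℚ._< B⁻¹ ℚ.* ε) (ℚ.*-zeroʳ B⁻¹) (ℚ.*-monoʳ-<-pos B⁻¹ 0<ε))
  in N , λ m n N≤m N≤n →
    let d = seq x m ℚ.- seq x n
        open ℚ.≤-Reasoning in begin-strict
    ℚ.∣ q ℚ.* seq x m ℚ.- q ℚ.* seq x n ∣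
      ≡⟨ cong ℚ.∣_∣ (*-factor q (seq x m) (seq x n)) ⟩
    ℚ.∣ q ℚ.* d ∣
      ≡⟨ ℚ.∣p*q∣≡∣p∣*∣q∣ q d ⟩
    ℚ.∣ q ∣ ℚ.* ℚ.∣ d ∣
      ≤⟨ ℚ.*-monoʳ-≤-nonNeg ℚ.∣ d ∣ {{ℚ.∣-∣-nonNeg d}} ∣q∣≤B ⟩
    B ℚ.* ℚ.∣ d ∣
      <⟨ ℚ.*-monoʳ-<-pos B (h m n N≤m N≤n) ⟩
    B ℚ.* (B⁻¹ ℚ.* ε)
      ≡⟨ ℚ.*-assoc B B⁻¹ ε ⟨
    (B ℚ.* B⁻¹) ℚ.* ε
      ≡⟨ cong (ℚ._* ε) (ℚ.*-inverseʳ B) ⟩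
    1ℚ ℚ.* ε
      ≡⟨ ℚ.*-identityˡ ε ⟩
    ε ∎
  where
  q = z ℚ./ 1
  B = 1ℚ ℚ.+ ℚ.∣ q ∣
  instance
    B-pos : ℚ.Positive B
    B-pos = ℚ.pos+nonNeg⇒pos 1ℚ ℚ.∣ q ∣ {{ℚ.∣-∣-nonNeg q}}
    B-nonZero : ℚ.NonZero B
    B-nonZero = ℚ.pos⇒nonZero B
  B⁻¹ = ℚ.1/ B
  instance
    B⁻¹-pos : ℚ.Positive B⁻¹
    B⁻¹-pos = ℚ.1/pos⇒pos B
  ∣q∣≤B : ℚ.∣ q ∣ ℚ.≤ B
  ∣q∣≤B = subst (ℚ._≤ B) (ℚ.+-identityˡ ℚ.∣ q ∣)
            (ℚ.+-monoˡ-≤ ℚ.∣ q ∣ (ℚ.nonNegative⁻¹ 1ℚ))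

sumℝ : ∀ {m} → Vector ℝ m → ℝ
sumℝ = foldr _+ℝ_ 0ℝ

linComb : ∀ {m n} → Vector ℝ m → (Fin m → Vector ℤ n) → Vector ℝ n
linComb c u a = sumℝ (λ r → u r a ·ℝ c r)

SpansRⁿ : ∀ {m n} → (Fin m → Vector ℤ n) → Set
SpansRⁿ {m} {n} u =
  ∀ (x : Vector ℝ n) → ∃[ c ] (∀ a → linComb c u a ≈ℝ x a)

LinearlyIndependent : ∀ {m n} → (Fin m → Vector ℤ n) → Set
LinearlyIndependent {m} {n} u =
  ∀ (c : Vector ℝ m) → (∀ a → linComb c u a ≈ℝ 0ℝ) → ∀ r → c r ≈ℝ 0ℝ

-- In particular the zero vector (also for n = 0) is not primitive.
Primitive : ∀ {n} → Vector ℤ n → Set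
Primitive v = ∀ (d : ℕ) → (∀ a → + d ∣ v a) → d ≡ 1

-- (ℤⁿ)^∨, in coordinates with respect to the dual standard basis.
Dual : ℕ → Set
Dual n = Vector ℤ n

infix 8 _⟨_⟩

_⟨_⟩ : ∀ {n} → Dual n → Vector ℤ n → ℤ
l ⟨ v ⟩ = sumℤ (λ a → l a ℤ.* v a)

-- One-dimensional tropical fans.  A ray is given by its primitive
-- generator, so rays are distinct iff their generators are.

record TropicalFan (n : ℕ) : Set where
  field
    #rays      : ℕ
    gen        : Fin #rays → Vector ℤ n
    weight     : Fin #rays → ℕ
    gen-prim   : ∀ r → Primitive (gen r)
    distinct   : ∀ r s → (∀ a → gen r a ≡ gen s a) → r ≡ s
    weight-pos : ∀ r → 0 ℕ.< weight r
    balanced   : ∀ a → sumℤ (λ r → + weight r ℤ.* gen r a) ≡ 0ℤ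

  Ray : Set
  Ray = Fin #rays

module _ {n : ℕ} (F : TropicalFan n) where
  open TropicalFan F

  max0·F : Dual n → ℤ
  max0·F l = sumℤ (λ r → + weight r ℤ.* (0ℤ ℤ.⊔ l ⟨ gen r ⟩))

  galleryOver : Dual n → Pred Ray 0ℓ
  galleryOver l r = ℤ.∣ l ⟨ gen r ⟩ ∣ ≡ 1

  Gly : Pred Ray 0ℓ → Set
  Gly S = Σ[ l ∈ Dual n ] (max0·F l ≡ 1ℤ × S ≐ galleryOver l)

  -- g_l(v_a,v_b) ∈ Gly(F)
  record IsGallery (l : Dual n) (a b : Ray) : Set where
    field
      max0·F≡1 : max0·F l ≡ 1ℤ
      gallery  : ｛ a ｝ ∪ ｛ b ｝ ≐ galleryOver l
      l⟨a⟩≡1   : l ⟨ gen a ⟩ ≡ 1ℤ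
      l⟨b⟩≡-1  : l ⟨ gen b ⟩ ≡ -1ℤ

  GalleryRelated : Ray → Ray → Set
  GalleryRelated a b = a ≡ b ⊎ Gly (｛ a ｝ ∪ ｛ b ｝)

  IsGalleryClass : Pred Ray 0ℓ → Set
  IsGalleryClass P = ∃[ a ] (P ≐ GalleryRelated a)

Image : {A B : Set} → (A → B) → Pred B 0ℓ
Image f b = ∃[ a ] f a ≡ b

matrixMap : ∀ {k n} → (Fin k → Dual n) → Vector ℤ n → Vector ℤ k
matrixMap rows x j = rows j ⟨ x ⟩

private
  ⟨⟩-zero : ∀ {n} (l : Dual n) → l ⟨ (λ _ → 0ℤ) ⟩ ≡ 0ℤ
  ⟨⟩-zero {n} l = trans (Sumℤ.sum-cong-≗ (λ a → ℤ.*-zeroʳ (l a)))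
                    (Sumℤ.sum-replicate-zero n)

  ⟨⟩-+ : ∀ {n} (l : Dual n) (x y : Vector ℤ n) →
         l ⟨ (λ a → x a ℤ.+ y a) ⟩ ≡ l ⟨ x ⟩ ℤ.+ l ⟨ y ⟩
  ⟨⟩-+ l x y = trans
    (Sumℤ.sum-cong-≗ (λ a → ℤ.*-distribˡ-+ (l a) (x a) (y a)))
    (Sumℤ.∑-distrib-+ (λ a → l a ℤ.* x a) (λ a → l a ℤ.* y a))

  ⟨⟩-neg : ∀ {n} (l : Dual n) (x : Vector ℤ n) →
           l ⟨ (λ a → ℤ.- x a) ⟩ ≡ ℤ.- (l ⟨ x ⟩)
  ⟨⟩-neg l x = begin
    l ⟨ (λ a → ℤ.- x a) ⟩
      ≡⟨ Sumℤ.sum-cong-≗ (λ a → lem (l a) (x a)) ⟩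
    sumℤ (λ a → -1ℤ ℤ.* (l a ℤ.* x a))
      ≡⟨ Sumℤ.*-distribˡ-sum -1ℤ (λ a → l a ℤ.* x a) ⟨
    -1ℤ ℤ.* l ⟨ x ⟩
      ≡⟨ ℤ.-1*i≡-i (l ⟨ x ⟩) ⟩
    ℤ.- (l ⟨ x ⟩) ∎
    where
    open ≡-Reasoning
    lem : ∀ b c → b ℤ.* ℤ.- c ≡ -1ℤ ℤ.* (b ℤ.* c)
    lem = solve-∀

  neg-minus : ∀ b c → c ℤ.- b ≡ ℤ.- (b ℤ.- c)
  neg-minus = solve-∀

  minus-trans : ∀ b c d → b ℤ.- d ≡ (b ℤ.- c) ℤ.+ (c ℤ.- d)
  minus-trans = solve-∀

-- y and y′ are identified iff y - y′ lies in the image of the map.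
ℤᵏ/image : ∀ {k n} → (Fin k → Dual n) → Setoid 0ℓ 0ℓ
ℤᵏ/image {k} {n} rows = record
  { Carrier       = Vector ℤ k
  ; _≈_           = λ y y′ → Σ[ x ∈ Vector ℤ n ] (∀ j → y j ℤ.- y′ j ≡ matrixMap rows x j)
  ; isEquivalence = record
    { refl  = λ {y} → (λ _ → 0ℤ) , λ j →
        trans (ℤ.+-inverseʳ (y j)) (sym (⟨⟩-zero (rows j)))
    ; sym   = λ {y} {y′} (x , h) → (λ a → ℤ.- x a) , λ j →
        trans (neg-minus (y j) (y′ j))
          (trans (cong ℤ.-_ (h j)) (sym (⟨⟩-neg (rows j) x)))
    ; trans = λ {y} {y′} {y″} (x , h) (x′ , h′) → (λ a → x a ℤ.+ x′ a) , λ j →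
        trans (minus-trans (y j) (y′ j) (y″ j))
          (trans (cong₂ ℤ._+_ (h j) (h′ j)) (sym (⟨⟩-+ (rows j) x x′)))
    }
  }

HasCardinality : Setoid 0ℓ 0ℓ → ℕ → Set
HasCardinality S m = Inverse S (setoid (Fin m))

{-# OPTIONS --safe #-}

-- Balancing turns max(0,l)·F = 1 into max(0,-l)·F = 1.  Since v_a already
-- contributes at least 1 to the first sum and v_b to the second, a functional
-- with g_l(v_a,v_b) ∈ Gly(F) vanishes on every other generator.  Hence
-- l_ij(v_j') = -δ_jj' for j, j' ≠ i: evaluating a linear relation among the
-- l_ij at the v_j kills its coefficients, and y ∈ ℤᵏ is the image of
-- -Σ_j y_j v_j.

module Submission where

open import Defs
import Algebra.Properties.CommutativeMonoid.Sum
import Algebra.Properties.Semiring.Sum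
open import Algebra.Bundles using (CommutativeMonoid; CommutativeRing)
open import Data.Fin.Base using (Fin; zero; suc; punchIn; punchOut)
import Data.Fin.Properties as Fin
open import Data.Integer.Base as ℤ using (ℤ; 0ℤ; 1ℤ; -1ℤ; +_; -[1+_]; +[1+_])
import Data.Integer.Properties as ℤ
open import Data.Integer.Tactic.RingSolver using (solve-∀)
open import Data.Nat.Base as ℕ using (ℕ; suc; _≤_)
import Data.Nat.Properties as ℕ
open import Data.Product.Base using (_×_; _,_; ∃-syntax)
open import Data.Rational.Base as ℚ using (ℚ; 0ℚ; 1ℚ; ½)
import Data.Rational.Properties as ℚ
open import Data.Rational.Unnormalised.Base as ℚᵘ using (mkℚᵘ; *≡*)
import Data.Rational.Unnormalised.Properties as ℚᵘ
open import Data.Sum.Base using (inj₁; inj₂)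
open import Data.Vec.Functional using (Vector; removeAt; replicate)
open import Function.Base using (_∘_)
open import Function.Definitions using (Injective)
open import Relation.Binary.PropositionalEquality using (_≡_; _≢_; refl; sym; trans; cong; subst; module ≡-Reasoning)
open import Relation.Nullary.Negation using (contradiction)

module Sumℚ = Algebra.Properties.Semiring.Sum
  (CommutativeRing.semiring ℚ.+-*-commutativeRing)

open Sumℤ using () renaming (sum to sumℤ)
open Sumℚ using () renaming (sum to sumℚ)

-- Finite sums with at most one nonzero term, and sums of nonnegative integers.

module _ {c ℓ} (M : CommutativeMonoid c ℓ) where
  open CommutativeMonoid M using (Carrier; _≈_; ε; identityʳ; ∙-congˡ)
    renaming (trans to ≈-trans)
  open Algebra.Properties.CommutativeMonoid.Sum M

  -- Stated over a commutative monoid because it collapses both rational sums (linear independence)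
  -- and integer sums (surjectivity) to their diagonal term.
  sum-single : ∀ {m} (t : Vector Carrier m) i →
               (∀ r → r ≢ i → t r ≈ ε) → sum t ≈ t i
  sum-single {suc m} t i t≈0 =
    ≈-trans (sum-remove {i = i} t)
      (≈-trans (∙-congˡ (≈-trans
        (sum-cong-≋ (λ r → t≈0 (punchIn i r) (Fin.punchInᵢ≢i i r)))
        (sum-replicate-zero m)))
      (identityʳ (t i)))

sum-nonNeg : ∀ {m} (f : Vector ℤ m) → (∀ r → 0ℤ ℤ.≤ f r) → 0ℤ ℤ.≤ sumℤ f
sum-nonNeg {ℕ.zero} f f≥0 = ℤ.≤-refl
sum-nonNeg {suc m}  f f≥0 =
  ℤ.+-mono-≤ (f≥0 zero) (sum-nonNeg (f ∘ suc) (f≥0 ∘ suc))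

term≤sum : ∀ {m} (f : Vector ℤ m) → (∀ r → 0ℤ ℤ.≤ f r) → ∀ i → f i ℤ.≤ sumℤ f
term≤sum {suc m} f f≥0 i = begin
  f i                         ≡⟨ ℤ.+-identityʳ (f i) ⟨
  f i ℤ.+ 0ℤ                  ≤⟨ ℤ.+-monoʳ-≤ (f i) (sum-nonNeg (removeAt f i) (f≥0 ∘ punchIn i)) ⟩
  f i ℤ.+ sumℤ (removeAt f i) ≡⟨ Sumℤ.sum-remove f ⟨
  sumℤ f                      ∎
  where open ℤ.≤-Reasoning

-- The terms other than `f i` add up to `1 - f i`, which is at most 0, and a nonnegative term is
-- bounded by the sum it belongs to.
sum≡1⇒others≡0 : ∀ {m} (f : Vector ℤ m) → (∀ r → 0ℤ ℤ.≤ f r) → sumℤ f ≡ 1ℤ →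
                 ∀ i → 1ℤ ℤ.≤ f i → ∀ r → r ≢ i → f r ≡ 0ℤ
sum≡1⇒others≡0 {suc m} f f≥0 Σf≡1 i 1≤fi r r≢i = ℤ.≤-antisym fr≤0 (f≥0 r)
  where
  open ℤ.≤-Reasoning
  rest : ℤ
  rest = sumℤ (removeAt f i)
  i≢r : i ≢ r
  i≢r = r≢i ∘ sym
  cancel : ∀ x y → y ≡ (x ℤ.+ y) ℤ.- x
  cancel = solve-∀
  fr≤0 : f r ℤ.≤ 0ℤ
  fr≤0 = begin
    f r                           ≡⟨ cong f (Fin.punchIn-punchOut i≢r) ⟨
    removeAt f i (punchOut i≢r)   ≤⟨ term≤sum (removeAt f i) (f≥0 ∘ punchIn i) (punchOut i≢r) ⟩
    rest                          ≡⟨ cancel (f i) rest ⟩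
    (f i ℤ.+ rest) ℤ.- f i        ≡⟨ cong (ℤ._- f i) (Sumℤ.sum-remove f) ⟨
    sumℤ f ℤ.- f i                ≡⟨ cong (ℤ._- f i) Σf≡1 ⟩
    1ℤ ℤ.- f i                    ≤⟨ ℤ.i≤j⇒i-j≤0 1≤fi ⟩
    0ℤ                            ∎

⟨⟩-linComb : ∀ {m n} (l : Dual n) (c : Vector ℤ m) (w : Fin m → Vector ℤ n) →
             l ⟨ (λ a → sumℤ (λ s → c s ℤ.* w s a)) ⟩ ≡ sumℤ (λ s → c s ℤ.* l ⟨ w s ⟩)
⟨⟩-linComb l c w = begin
  sumℤ (λ a → l a ℤ.* sumℤ (λ s → c s ℤ.* w s a))
    ≡⟨ Sumℤ.sum-cong-≗ (λ a → Sumℤ.*-distribˡ-sum (l a) (λ s → c s ℤ.* w s a)) ⟩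
  sumℤ (λ a → sumℤ (λ s → l a ℤ.* (c s ℤ.* w s a)))
    ≡⟨ Sumℤ.∑-comm (λ a s → l a ℤ.* (c s ℤ.* w s a)) ⟩
  sumℤ (λ s → sumℤ (λ a → l a ℤ.* (c s ℤ.* w s a)))
    ≡⟨ Sumℤ.sum-cong-≗ (λ s → Sumℤ.sum-cong-≗ (λ a → swap (l a) (c s) (w s a))) ⟩
  sumℤ (λ s → sumℤ (λ a → c s ℤ.* (l a ℤ.* w s a)))
    ≡⟨ Sumℤ.sum-cong-≗ (λ s → Sumℤ.*-distribˡ-sum (c s) (λ a → l a ℤ.* w s a)) ⟨
  sumℤ (λ s → c s ℤ.* l ⟨ w s ⟩) ∎
  where
  open ≡-Reasoning
  swap : ∀ x y z → x ℤ.* (y ℤ.* z) ≡ y ℤ.* (x ℤ.* z)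
  swap = solve-∀

-- Positive and negative parts, balancing, and the vanishing of gallery functionals.

pos-part-split : ∀ x → 0ℤ ℤ.⊔ x ≡ x ℤ.+ (0ℤ ℤ.⊔ ℤ.- x)
pos-part-split (+ 0)    = refl
pos-part-split +[1+ m ] = sym (ℤ.+-identityʳ +[1+ m ])
pos-part-split -[1+ m ] = sym (ℤ.+-inverseʳ -[1+ m ])

pos-parts≡0⇒≡0 : ∀ x → 0ℤ ℤ.⊔ x ≡ 0ℤ → 0ℤ ℤ.⊔ ℤ.- x ≡ 0ℤ → x ≡ 0ℤ
pos-parts≡0⇒≡0 (+ 0)    _ _ = refl
pos-parts≡0⇒≡0 +[1+ _ ] () _
pos-parts≡0⇒≡0 -[1+ _ ] _ ()

module _ {n} (F : TropicalFan n) where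
  open TropicalFan F

  weighted-pos-part : (Ray → ℤ) → Vector ℤ #rays
  weighted-pos-part f r = + weight r ℤ.* (0ℤ ℤ.⊔ f r)

  -- The weighted positive and negative parts differ by the weighted sum of the values of `l`, which
  -- is `l` applied to the balanced sum of generators, hence 0.
  sum-neg-parts≡max0·F : ∀ l → sumℤ (weighted-pos-part (λ r → ℤ.- (l ⟨ gen r ⟩))) ≡ max0·F F l
  sum-neg-parts≡max0·F l = sym (begin
    sumℤ (λ r → + weight r ℤ.* (0ℤ ℤ.⊔ L r))
      ≡⟨ Sumℤ.sum-cong-≗ (λ r → trans (cong (+ weight r ℤ.*_) (pos-part-split (L r)))
           (ℤ.*-distribˡ-+ (+ weight r) (L r) (0ℤ ℤ.⊔ ℤ.- L r))) ⟩
    sumℤ (λ r → + weight r ℤ.* L r ℤ.+ negPart r)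
      ≡⟨ Sumℤ.∑-distrib-+ (λ r → + weight r ℤ.* L r) negPart ⟩
    sumℤ (λ r → + weight r ℤ.* L r) ℤ.+ sumℤ negPart
      ≡⟨ cong (ℤ._+ sumℤ negPart) balanced-L ⟩
    0ℤ ℤ.+ sumℤ negPart
      ≡⟨ ℤ.+-identityˡ (sumℤ negPart) ⟩
    sumℤ negPart ∎)
    where
    open ≡-Reasoning
    L : Ray → ℤ
    L r = l ⟨ gen r ⟩
    negPart : Vector ℤ #rays
    negPart = weighted-pos-part (λ r → ℤ.- L r)
    balanced-L : sumℤ (λ r → + weight r ℤ.* L r) ≡ 0ℤ
    balanced-L = begin
      sumℤ (λ r → + weight r ℤ.* L r)
        ≡⟨ ⟨⟩-linComb l (λ r → + weight r) gen ⟨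
      l ⟨ (λ a → sumℤ (λ r → + weight r ℤ.* gen r a)) ⟩
        ≡⟨ Sumℤ.sum-cong-≗ (λ a → trans (cong (l a ℤ.*_) (balanced a)) (ℤ.*-zeroʳ (l a))) ⟩
      sumℤ (replicate n 0ℤ)
        ≡⟨ Sumℤ.sum-replicate-zero n ⟩
      0ℤ ∎

  -- The term at `a` equals `weight a`, so it is at least 1 and uses up the whole sum; positivity of
  -- the weights then removes the factor `weight r`. An arbitrary `f` covers both `l` and its
  -- negative.
  pos-part-vanishes : ∀ f → sumℤ (weighted-pos-part f) ≡ 1ℤ →
                      ∀ a → f a ≡ 1ℤ → ∀ r → r ≢ a → 0ℤ ℤ.⊔ f r ≡ 0ℤ
  pos-part-vanishes f Σ≡1 a fa≡1 r r≢a
    with ℤ.i*j≡0⇒i≡0∨j≡0 (+ weight r)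
           (sum≡1⇒others≡0 (weighted-pos-part f) nonNeg Σ≡1 a 1≤term r r≢a)
    where
    nonNeg : ∀ s → 0ℤ ℤ.≤ weighted-pos-part f s
    nonNeg s = subst (ℤ._≤ weighted-pos-part f s) (ℤ.*-zeroʳ (+ weight s))
      (ℤ.*-monoˡ-≤-nonNeg (+ weight s) (ℤ.i≤i⊔j 0ℤ (f s)))
    1≤term : 1ℤ ℤ.≤ weighted-pos-part f a
    1≤term = subst (1ℤ ℤ.≤_)
      (sym (trans (cong (λ x → + weight a ℤ.* (0ℤ ℤ.⊔ x)) fa≡1) (ℤ.*-identityʳ (+ weight a))))
      (ℤ.+≤+ (weight-pos a))
  ... | inj₁ w≡0 = contradiction (sym (ℤ.+-injective w≡0)) (ℕ.<⇒≢ (weight-pos r))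
  ... | inj₂ p≡0 = p≡0

  gallery-vanishes : ∀ {l a b} → IsGallery F l a b →
                     ∀ r → r ≢ a → r ≢ b → l ⟨ gen r ⟩ ≡ 0ℤ
  gallery-vanishes {l} {a} {b} g r r≢a r≢b = pos-parts≡0⇒≡0 (l ⟨ gen r ⟩)
    (pos-part-vanishes (λ s → l ⟨ gen s ⟩) max0·F≡1 a l⟨a⟩≡1 r r≢a)
    -- For the negative of `l` the roles are exchanged: `b` is the ray of value 1.
    (pos-part-vanishes (λ s → ℤ.- (l ⟨ gen s ⟩))
      (trans (sum-neg-parts≡max0·F l) max0·F≡1) b (cong ℤ.-_ l⟨b⟩≡-1) r r≢b)
    where open IsGallery g

-- Integers as rationals, and rational combinations of integer functionals.

fromℤ : ℤ → ℚ
fromℤ z = z ℚ./ 1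

-- Normalised fractions do not compute on variables, so the identity is checked on unnormalised
-- ones, where it is a cross-multiplication.
fromℤ-+ : ∀ x y → fromℤ (x ℤ.+ y) ≡ fromℤ x ℚ.+ fromℤ y
fromℤ-+ x y = ℚ.toℚᵘ-injective (begin-equality
  ℚ.toℚᵘ (fromℤ (x ℤ.+ y))                   ≃⟨ ℚ.toℚᵘ-fromℚᵘ (mkℚᵘ (x ℤ.+ y) 0) ⟩
  mkℚᵘ (x ℤ.+ y) 0                           ≃⟨ *≡* (unit x y) ⟩
  mkℚᵘ x 0 ℚᵘ.+ mkℚᵘ y 0                     ≃⟨ ℚᵘ.+-cong (ℚ.toℚᵘ-fromℚᵘ (mkℚᵘ x 0)) (ℚ.toℚᵘ-fromℚᵘ (mkℚᵘ y 0)) ⟨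
  ℚ.toℚᵘ (fromℤ x) ℚᵘ.+ ℚ.toℚᵘ (fromℤ y)     ≃⟨ ℚ.toℚᵘ-homo-+ (fromℤ x) (fromℤ y) ⟨
  ℚ.toℚᵘ (fromℤ x ℚ.+ fromℤ y)               ∎)
  where
  open ℚᵘ.≤-Reasoning
  unit : ∀ x y → (x ℤ.+ y) ℤ.* 1ℤ ≡ (x ℤ.* 1ℤ ℤ.+ y ℤ.* 1ℤ) ℤ.* 1ℤ
  unit = solve-∀

fromℤ-* : ∀ x y → fromℤ (x ℤ.* y) ≡ fromℤ x ℚ.* fromℤ y
fromℤ-* x y = ℚ.toℚᵘ-injective (begin-equality
  ℚ.toℚᵘ (fromℤ (x ℤ.* y))                   ≃⟨ ℚ.toℚᵘ-fromℚᵘ (mkℚᵘ (x ℤ.* y) 0) ⟩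
  mkℚᵘ x 0 ℚᵘ.* mkℚᵘ y 0                     ≃⟨ ℚᵘ.*-cong (ℚ.toℚᵘ-fromℚᵘ (mkℚᵘ x 0)) (ℚ.toℚᵘ-fromℚᵘ (mkℚᵘ y 0)) ⟨
  ℚ.toℚᵘ (fromℤ x) ℚᵘ.* ℚ.toℚᵘ (fromℤ y)     ≃⟨ ℚ.toℚᵘ-homo-* (fromℤ x) (fromℤ y) ⟨
  ℚ.toℚᵘ (fromℤ x ℚ.* fromℤ y)               ∎)
  where open ℚᵘ.≤-Reasoning

fromℤ-sum : ∀ {m} (f : Vector ℤ m) → fromℤ (sumℤ f) ≡ sumℚ (fromℤ ∘ f)
fromℤ-sum {ℕ.zero} f = refl
fromℤ-sum {suc m}  f = trans (fromℤ-+ (f zero) (sumℤ (f ∘ suc)))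
  (cong (fromℤ (f zero) ℚ.+_) (fromℤ-sum (f ∘ suc)))

-- Exchanging the two sums evaluates a combination of the functionals at `w`. Rational coefficients
-- suffice because this is applied at each index of the Cauchy sequences.
evaluate-linComb : ∀ {m n} (u : Fin m → Dual n) (w : Vector ℤ n) (c : Vector ℚ m) →
  sumℚ (λ a → fromℤ (w a) ℚ.* sumℚ (λ r → fromℤ (u r a) ℚ.* c r))
    ≡ sumℚ (λ r → fromℤ (u r ⟨ w ⟩) ℚ.* c r)
evaluate-linComb u w c = begin
  sumℚ (λ a → fromℤ (w a) ℚ.* sumℚ (λ r → fromℤ (u r a) ℚ.* c r))
    ≡⟨ Sumℚ.sum-cong-≗ (λ a → Sumℚ.*-distribˡ-sum (fromℤ (w a)) (λ r → fromℤ (u r a) ℚ.* c r)) ⟩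
  sumℚ (λ a → sumℚ (λ r → fromℤ (w a) ℚ.* (fromℤ (u r a) ℚ.* c r)))
    ≡⟨ Sumℚ.∑-comm (λ a r → fromℤ (w a) ℚ.* (fromℤ (u r a) ℚ.* c r)) ⟩
  sumℚ (λ r → sumℚ (λ a → fromℤ (w a) ℚ.* (fromℤ (u r a) ℚ.* c r)))
    ≡⟨ Sumℚ.sum-cong-≗ (λ r → Sumℚ.sum-cong-≗ (λ a → regroup (w a) (u r a) (c r))) ⟩
  sumℚ (λ r → sumℚ (λ a → fromℤ (u r a ℤ.* w a) ℚ.* c r))
    ≡⟨ Sumℚ.sum-cong-≗ (λ r → Sumℚ.*-distribʳ-sum (c r) (λ a → fromℤ (u r a ℤ.* w a))) ⟨
  sumℚ (λ r → sumℚ (λ a → fromℤ (u r a ℤ.* w a)) ℚ.* c r)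
    ≡⟨ Sumℚ.sum-cong-≗ (λ r → cong (ℚ._* c r) (fromℤ-sum (λ a → u r a ℤ.* w a))) ⟨
  sumℚ (λ r → fromℤ (u r ⟨ w ⟩) ℚ.* c r) ∎
  where
  open ≡-Reasoning
  regroup : ∀ x y q → fromℤ x ℚ.* (fromℤ y ℚ.* q) ≡ fromℤ (y ℤ.* x) ℚ.* q
  regroup x y q = begin
    fromℤ x ℚ.* (fromℤ y ℚ.* q)   ≡⟨ ℚ.*-assoc (fromℤ x) (fromℤ y) q ⟨
    (fromℤ x ℚ.* fromℤ y) ℚ.* q   ≡⟨ cong (ℚ._* q) (fromℤ-* x y) ⟨
    fromℤ (x ℤ.* y) ℚ.* q         ≡⟨ cong (λ z → fromℤ z ℚ.* q) (ℤ.*-comm x y) ⟩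
    fromℤ (y ℤ.* x) ℚ.* q         ∎

-- Rational sequences converging to zero.

Null : (ℕ → ℚ) → Set
Null s = ∀ ε → 0ℚ ℚ.< ε → ∃[ N ] (∀ n → N ≤ n → ℚ.∣ s n ∣ ℚ.< ε)

Null-dominated : ∀ {s t} B .{{_ : ℚ.Positive B}} → Null t →
                 (∀ n → ℚ.∣ s n ∣ ℚ.≤ B ℚ.* ℚ.∣ t n ∣) → Null s
Null-dominated {s} {t} B t→0 s≤Bt ε 0<ε =
  let N , h = t→0 (B⁻¹ ℚ.* ε)
                (subst (ℚ._< B⁻¹ ℚ.* ε) (ℚ.*-zeroʳ B⁻¹) (ℚ.*-monoʳ-<-pos B⁻¹ 0<ε))
  in N , λ n N≤n → let open ℚ.≤-Reasoning in begin-strict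
    ℚ.∣ s n ∣           ≤⟨ s≤Bt n ⟩
    B ℚ.* ℚ.∣ t n ∣     <⟨ ℚ.*-monoʳ-<-pos B (h n N≤n) ⟩
    B ℚ.* (B⁻¹ ℚ.* ε)   ≡⟨ ℚ.*-assoc B B⁻¹ ε ⟨
    (B ℚ.* B⁻¹) ℚ.* ε   ≡⟨ cong (ℚ._* ε) (ℚ.*-inverseʳ B) ⟩
    1ℚ ℚ.* ε            ≡⟨ ℚ.*-identityˡ ε ⟩
    ε                   ∎
  where
  instance
    B-nonZero : ℚ.NonZero B
    B-nonZero = ℚ.pos⇒nonZero B
  B⁻¹ : ℚ
  B⁻¹ = ℚ.1/ B
  instance
    B⁻¹-pos : ℚ.Positive B⁻¹
    B⁻¹-pos = ℚ.1/pos⇒pos B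

Null-* : ∀ q {t} → Null t → Null (λ n → q ℚ.* t n)
Null-* q {t} t→0 = Null-dominated B t→0 λ n → let open ℚ.≤-Reasoning in begin
  ℚ.∣ q ℚ.* t n ∣           ≡⟨ ℚ.∣p*q∣≡∣p∣*∣q∣ q (t n) ⟩
  ℚ.∣ q ∣ ℚ.* ℚ.∣ t n ∣     ≤⟨ ℚ.*-monoʳ-≤-nonNeg ℚ.∣ t n ∣ {{ℚ.∣-∣-nonNeg (t n)}} ∣q∣≤B ⟩
  B ℚ.* ℚ.∣ t n ∣           ∎
  where
  -- The summand 1 keeps the bound positive, hence invertible, even for `q` equal to 0.
  B : ℚ
  B = 1ℚ ℚ.+ ℚ.∣ q ∣
  instance
    B-pos : ℚ.Positive B
    B-pos = ℚ.pos+nonNeg⇒pos 1ℚ ℚ.∣ q ∣ {{ℚ.∣-∣-nonNeg q}}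
  ∣q∣≤B : ℚ.∣ q ∣ ℚ.≤ B
  ∣q∣≤B = subst (ℚ._≤ B) (ℚ.+-identityˡ ℚ.∣ q ∣)
            (ℚ.+-monoˡ-≤ ℚ.∣ q ∣ (ℚ.nonNegative⁻¹ 1ℚ))

Null-+ : ∀ {s t} → Null s → Null t → Null (λ n → s n ℚ.+ t n)
Null-+ {s} {t} s→0 t→0 ε 0<ε =
  let M , hs = s→0 (½ ℚ.* ε) 0<½ε
      N , ht = t→0 (½ ℚ.* ε) 0<½ε
  in M ℕ.⊔ N , λ n M⊔N≤n → let open ℚ.≤-Reasoning in begin-strict
    ℚ.∣ s n ℚ.+ t n ∣           ≤⟨ ℚ.∣p+q∣≤∣p∣+∣q∣ (s n) (t n) ⟩
    ℚ.∣ s n ∣ ℚ.+ ℚ.∣ t n ∣     <⟨ ℚ.+-mono-< (hs n (ℕ.m⊔n≤o⇒m≤o M N M⊔N≤n)) (ht n (ℕ.m⊔n≤o⇒n≤o M N M⊔N≤n)) ⟩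
    ½ ℚ.* ε ℚ.+ ½ ℚ.* ε         ≡⟨ ℚ.*-distribʳ-+ ε ½ ½ ⟨
    1ℚ ℚ.* ε                    ≡⟨ ℚ.*-identityˡ ε ⟩
    ε                           ∎
  where
  0<½ε : 0ℚ ℚ.< ½ ℚ.* ε
  0<½ε = subst (ℚ._< ½ ℚ.* ε) (ℚ.*-zeroʳ ½) (ℚ.*-monoʳ-<-pos ½ 0<ε)

Null-sum : ∀ {m} (f : Fin m → ℕ → ℚ) → (∀ a → Null (f a)) → Null (λ n → sumℚ (λ a → f a n))
Null-sum {ℕ.zero} f f→0 ε 0<ε = 0 , λ _ _ → 0<ε
Null-sum {suc m}  f f→0 = Null-+ (f→0 zero) (Null-sum (f ∘ suc) (f→0 ∘ suc))

-- Comparing absolute values only absorbs both the subtraction of 0 in `_≈ℝ_` and the sign in the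
-- duality relation.
Null-cong-∣∣ : ∀ {s t} → (∀ n → ℚ.∣ s n ∣ ≡ ℚ.∣ t n ∣) → Null s → Null t
Null-cong-∣∣ ∣s∣≡∣t∣ s→0 ε 0<ε =
  let N , h = s→0 ε 0<ε in N , λ n N≤n → subst (ℚ._< ε) (∣s∣≡∣t∣ n) (h n N≤n)

∣p-0∣≡∣p∣ : ∀ p → ℚ.∣ p ℚ.- 0ℚ ∣ ≡ ℚ.∣ p ∣
∣p-0∣≡∣p∣ p = cong ℚ.∣_∣ (ℚ.+-identityʳ p)

≈0⇒Null : ∀ {x} → x ≈ℝ 0ℝ → Null (seq x)
≈0⇒Null {x} = Null-cong-∣∣ (λ n → ∣p-0∣≡∣p∣ (seq x n))

Null⇒≈0 : ∀ {x} → Null (seq x) → x ≈ℝ 0ℝ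
Null⇒≈0 {x} = Null-cong-∣∣ (λ n → sym (∣p-0∣≡∣p∣ (seq x n)))

-- The real operations act termwise on sequences, and `fromℤ` is literally the factor used in
-- `_·ℝ_`, so only the recursion on `m` remains.
seq-linComb : ∀ {m n} (c : Vector ℝ m) (u : Fin m → Vector ℤ n) a N →
              seq (linComb c u a) N ≡ sumℚ (λ r → fromℤ (u r a) ℚ.* seq (c r) N)
seq-linComb {ℕ.zero} c u a N = refl
seq-linComb {suc m}  c u a N =
  cong (fromℤ (u zero a) ℚ.* seq (c zero) N ℚ.+_) (seq-linComb (c ∘ suc) (u ∘ suc) a N)

-- Functionals and vectors that are dual up to sign.

record NegDual {k n} (u : Fin k → Dual n) (w : Fin k → Vector ℤ n) : Set where
  field
    diagonal    : ∀ j → u j ⟨ w j ⟩ ≡ -1ℤ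
    offDiagonal : ∀ j s → j ≢ s → u j ⟨ w s ⟩ ≡ 0ℤ

module _ {k n} {u : Fin k → Dual n} {w : Fin k → Vector ℤ n} (dual : NegDual u w) where
  open NegDual dual

  -- Evaluating the relation at `w j` gives an integer combination of null sequences, so a null
  -- sequence; termwise it equals the negative of the sequence of `c j`.
  negDual⇒linearlyIndependent : LinearlyIndependent u
  negDual⇒linearlyIndependent c u·c≈0 j = Null⇒≈0 {c j} (Null-cong-∣∣ ∣value∣≡∣cⱼ∣
    (Null-sum _ (λ a → Null-* (fromℤ (w j a)) (≈0⇒Null {linComb c u a} (u·c≈0 a)))))
    where
    open ≡-Reasoning
    value≡-cⱼ : ∀ N → sumℚ (λ a → fromℤ (w j a) ℚ.* seq (linComb c u a) N) ≡ ℚ.- seq (c j) N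
    value≡-cⱼ N = begin
      sumℚ (λ a → fromℤ (w j a) ℚ.* seq (linComb c u a) N)
        ≡⟨ Sumℚ.sum-cong-≗ (λ a → cong (fromℤ (w j a) ℚ.*_) (seq-linComb c u a N)) ⟩
      sumℚ (λ a → fromℤ (w j a) ℚ.* sumℚ (λ r → fromℤ (u r a) ℚ.* seq (c r) N))
        ≡⟨ evaluate-linComb u (w j) (λ r → seq (c r) N) ⟩
      sumℚ (λ r → fromℤ (u r ⟨ w j ⟩) ℚ.* seq (c r) N)
        ≡⟨ sum-single ℚ.+-0-commutativeMonoid _ j (λ r r≢j →
             trans (cong (λ z → fromℤ z ℚ.* seq (c r) N) (offDiagonal r j r≢j))
                   (ℚ.*-zeroˡ (seq (c r) N))) ⟩
      fromℤ (u j ⟨ w j ⟩) ℚ.* seq (c j) N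
        ≡⟨ cong (λ z → fromℤ z ℚ.* seq (c j) N) (diagonal j) ⟩
      (ℚ.- 1ℚ) ℚ.* seq (c j) N
        ≡⟨ ℚ.neg-distribˡ-* 1ℚ (seq (c j) N) ⟨
      ℚ.- (1ℚ ℚ.* seq (c j) N)
        ≡⟨ cong ℚ.-_ (ℚ.*-identityˡ (seq (c j) N)) ⟩
      ℚ.- seq (c j) N ∎
    ∣value∣≡∣cⱼ∣ : ∀ N → ℚ.∣ sumℚ (λ a → fromℤ (w j a) ℚ.* seq (linComb c u a) N) ∣ ≡ ℚ.∣ seq (c j) N ∣
    ∣value∣≡∣cⱼ∣ N = trans (cong ℚ.∣_∣ (value≡-cⱼ N)) (ℚ.∣-p∣≡∣p∣ (seq (c j) N))

  negDual⇒surjective : ∀ (y : Vector ℤ k) → ∃[ x ] (∀ j → y j ≡ matrixMap u x j)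
  -- The coefficients are negated to compensate for the diagonal value -1.
  negDual⇒surjective y = (λ a → sumℤ (λ s → ℤ.- y s ℤ.* w s a)) , λ j → sym (begin
    u j ⟨ (λ a → sumℤ (λ s → ℤ.- y s ℤ.* w s a)) ⟩
      ≡⟨ ⟨⟩-linComb (u j) (λ s → ℤ.- y s) w ⟩
    sumℤ (λ s → ℤ.- y s ℤ.* u j ⟨ w s ⟩)
      ≡⟨ sum-single ℤ.+-0-commutativeMonoid _ j (λ s s≢j →
           trans (cong (ℤ.- y s ℤ.*_) (offDiagonal j s (s≢j ∘ sym))) (ℤ.*-zeroʳ (ℤ.- y s))) ⟩
    ℤ.- y j ℤ.* u j ⟨ w j ⟩
      ≡⟨ cong (ℤ.- y j ℤ.*_) (diagonal j) ⟩
    ℤ.- y j ℤ.* -1ℤ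
      ≡⟨ neg*neg1 (y j) ⟩
    y j ∎)
    where
    open ≡-Reasoning
    neg*neg1 : ∀ z → ℤ.- z ℤ.* -1ℤ ≡ z
    neg*neg1 = solve-∀

surjective⇒trivialCokernel : ∀ {k n} (u : Fin k → Dual n) →
  (∀ (y : Vector ℤ k) → ∃[ x ] (∀ j → y j ≡ matrixMap u x j)) → HasCardinality (ℤᵏ/image u) 1
surjective⇒trivialCokernel u surj = record
  { to        = λ _ → zero
  ; from      = λ _ _ → 0ℤ
  ; to-cong   = λ _ → refl
  ; from-cong = λ _ → surj (λ _ → 0ℤ)
  -- Every `y` is congruent to the chosen representative 0, since their difference has a preimage.
  ; inverse   = (λ { {zero} _ → refl }) , λ {y} _ → surj (λ j → 0ℤ ℤ.- y j)
  }

corollary3p12 : ∀ (n : ℕ) (F : TropicalFan n) →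
    SpansRⁿ (TropicalFan.gen F) →
    ∀ (k : ℕ) → 2 ≤ suc k →
    (v : Fin (suc k) → TropicalFan.Ray F) →
    Injective _≡_ _≡_ v →
    IsGalleryClass F (Image v) →
    (i : Fin (suc k)) →
    -- l j is the functional for the j-th index of {0,…,k} ∖ {i}
    (l : Fin k → Dual n) →
    (∀ j → IsGallery F (l j) (v i) (v (punchIn i j))) →
    LinearlyIndependent l × HasCardinality (ℤᵏ/image l) 1
corollary3p12 n F _ k _ v v-injective _ i l g =
  negDual⇒linearlyIndependent dual , surjective⇒trivialCokernel l (negDual⇒surjective dual)
  where
  open TropicalFan F using (gen)
  dual : NegDual l (λ j → gen (v (punchIn i j)))
  dual = record
    { diagonal    = λ j → IsGallery.l⟨b⟩≡-1 (g j)
    -- The ray of index `s` is neither end of the gallery of `l j`: `punchIn i` avoids `i` and is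
    -- injective, and `v` separates indices.
    ; offDiagonal = λ j s j≢s → gallery-vanishes F (g j) (v (punchIn i s))
        (λ eq → Fin.punchInᵢ≢i i s (v-injective eq))
        (λ eq → j≢s (sym (Fin.punchIn-injective i s j (v-injective eq))))
    }
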